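{- For any ccpBa $(A,1,0,\vee,\wedge,\rightarrow,\neg,\sim)$, the reduct $(A,1,0,\vee,\wedge,\neg,\sim)$ is a $K_{im}$-algebra.
   Context: A relatively pseudo-complemented (rpc) lattice is a lattice with a binary operation $\rightarrow$ satisfying $a\wedge x\leq b\Leftrightarrow x\leq a\rightarrow b$. A ccpBa is an algebra $(A,1,0,\vee,\wedge,\rightarrow,\neg,\sim)$ such that $(A,1,0,\vee,\wedge,\rightarrow)$ is a bounded rpc lattice and, for all $a\in A$, $\neg a=a\rightarrow 0$ and $\sim a=a\rightarrow(\neg\neg\sim 1)$. On a bounded distributive lattice $(A,1,0,\vee,\wedge)$, a unary operation $n$ is a preminimal negation if $a\leq b\Rightarrow nb\leq na$, $na\wedge nb\leq n(a\vee b)$ and $n0=1$; a minimal negation if moreover $a\leq nna$ and $a\wedge b\leq c\Rightarrow a\wedge nc\leq nb$; an intuitionistic negation if moreover $a\wedge na\leq b$ for all $a,b$. A $K_{im}$-algebra is $(A,1,0,\vee,\wedge,\neg,\sim)$ with $(A,1,0,\vee,\wedge)$ a bounded distributive lattice, $\neg$ an intuitionistic negation, $\sim$ a minimal negation, and $\neg\neg\sim1=\sim1$. -}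

module Defs where

open import Algebra.Core using (Op₁; Op₂)
open import Level using (suc; _⊔_)
open import Relation.Binary.Core using (Rel)
open import Relation.Binary.Definitions using (Maximum; Minimum)
open import Relation.Binary.Lattice.Structures
  using (IsDistributiveLattice; IsHeytingAlgebra)

-- As in Relation.Binary.Lattice, algebras carry a setoid equality _≈_ and their
-- lattice order _≤_.  No congruence fields are needed for ⇨, ¬ and ∼: in each
-- structure below they follow from the stated laws.

module _ {a ℓ₁ ℓ₂} {A : Set a} (_≈_ : Rel A ℓ₁) (_≤_ : Rel A ℓ₂) where

  record IsBoundedDistributiveLattice
           (_∨_ _∧_ : Op₂ A) (⊤ ⊥ : A) : Set (a ⊔ ℓ₁ ⊔ ℓ₂) where
    field
      isDistributiveLattice : IsDistributiveLattice _≈_ _≤_ _∨_ _∧_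
      maximum               : Maximum _≤_ ⊤
      minimum               : Minimum _≤_ ⊥

    open IsDistributiveLattice isDistributiveLattice public

  -- The three negation structures are meant over a bounded distributive lattice;
  -- that assumption is supplied where they are used.

  record IsPreminimalNegation
           (_∨_ _∧_ : Op₂ A) (⊤ ⊥ : A) (n : Op₁ A) : Set (a ⊔ ℓ₁ ⊔ ℓ₂) where
    field
      antitone : ∀ {x y} → x ≤ y → n y ≤ n x
      n-∨      : ∀ x y → (n x ∧ n y) ≤ n (x ∨ y)
      n-⊥      : n ⊥ ≈ ⊤

  record IsMinimalNegation
           (_∨_ _∧_ : Op₂ A) (⊤ ⊥ : A) (n : Op₁ A) : Set (a ⊔ ℓ₁ ⊔ ℓ₂) where
    field
      isPreminimalNegation : IsPreminimalNegation _∨_ _∧_ ⊤ ⊥ n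
      x≤nnx                : ∀ x → x ≤ n (n x)
      contraposition       : ∀ {x y z} → (x ∧ y) ≤ z → (x ∧ n z) ≤ n y

    open IsPreminimalNegation isPreminimalNegation public

  record IsIntuitionisticNegation
           (_∨_ _∧_ : Op₂ A) (⊤ ⊥ : A) (n : Op₁ A) : Set (a ⊔ ℓ₁ ⊔ ℓ₂) where
    field
      isMinimalNegation : IsMinimalNegation _∨_ _∧_ ⊤ ⊥ n
      explosion         : ∀ x y → (x ∧ n x) ≤ y

    open IsMinimalNegation isMinimalNegation public

  record IsKimAlgebra
           (_∨_ _∧_ : Op₂ A) (¬_ ∼_ : Op₁ A) (⊤ ⊥ : A) : Set (a ⊔ ℓ₁ ⊔ ℓ₂) where
    field
      isBoundedDistributiveLattice : IsBoundedDistributiveLattice _∨_ _∧_ ⊤ ⊥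
      ¬-isIntuitionisticNegation   : IsIntuitionisticNegation _∨_ _∧_ ⊤ ⊥ ¬_
      ∼-isMinimalNegation          : IsMinimalNegation _∨_ _∧_ ⊤ ⊥ ∼_
      ¬¬∼⊤≈∼⊤                      : (¬ (¬ (∼ ⊤))) ≈ (∼ ⊤)

    open IsBoundedDistributiveLattice isBoundedDistributiveLattice public

  -- A bounded relatively pseudo-complemented lattice is a Heyting algebra;
  -- distributivity is not among the fields of IsHeytingAlgebra.
  record IsCcpBa
           (_∨_ _∧_ _⇨_ : Op₂ A) (¬_ ∼_ : Op₁ A) (⊤ ⊥ : A) : Set (a ⊔ ℓ₁ ⊔ ℓ₂) where
    field
      isHeytingAlgebra : IsHeytingAlgebra _≈_ _≤_ _∨_ _∧_ _⇨_ ⊤ ⊥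
      ¬-def            : ∀ x → (¬ x) ≈ (x ⇨ ⊥)
      ∼-def            : ∀ x → (∼ x) ≈ (x ⇨ (¬ (¬ (∼ ⊤))))

    open IsHeytingAlgebra isHeytingAlgebra public

record CcpBa c ℓ₁ ℓ₂ : Set (suc (c ⊔ ℓ₁ ⊔ ℓ₂)) where
  infix  4 _≈_ _≤_
  infixr 5 _⇨_
  infixr 6 _∨_
  infixr 7 _∧_
  infix  8 ¬_ ∼_
  field
    Carrier : Set c
    _≈_     : Rel Carrier ℓ₁
    _≤_     : Rel Carrier ℓ₂
    _∨_     : Op₂ Carrier
    _∧_     : Op₂ Carrier
    _⇨_     : Op₂ Carrier
    ¬_      : Op₁ Carrier
    ∼_      : Op₁ Carrier
    ⊤       : Carrier
    ⊥       : Carrier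
    isCcpBa : IsCcpBa _≈_ _≤_ _∨_ _∧_ _⇨_ ¬_ ∼_ ⊤ ⊥

  open IsCcpBa isCcpBa public

{-# OPTIONS --safe #-}
-- Both negations of a ccpBa have the form n x = x ⇨ k, with k = ⊥ for ¬ and
-- k = ¬ ¬ ∼ ⊤ for ∼.  By residuation every such n is a minimal negation, and it is
-- intuitionistic when k is the bottom.  Finally ∼ ⊤ = ⊤ ⇨ ¬ ¬ ∼ ⊤ = ¬ ¬ ∼ ⊤.
module Submission where

open import Defs
open import Level using (Level)
open import Algebra.Core using (Op₁)
open import Relation.Binary.Lattice.Bundles using (HeytingAlgebra)
import Relation.Binary.Lattice.Properties.HeytingAlgebra as HeytingProperties
import Relation.Binary.Lattice.Properties.MeetSemilattice as MeetProperties

module _ {c ℓ₁ ℓ₂ : Level} (H : HeytingAlgebra c ℓ₁ ℓ₂) where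
  open HeytingAlgebra H
  open HeytingProperties H
    using (⇨-applyʳ; y≤x⇨y; ⇨-eval; ⇨-distribˡ-∨-∧-≥; isDistributiveLattice)
  open MeetProperties meetSemilattice using (∧-monotonic)

  ⇨-identityˡ : ∀ x → ⊤ ⇨ x ≈ x
  ⇨-identityˡ x = antisym (trans (∧-greatest refl (maximum _)) ⇨-eval) y≤x⇨y

  -- Distributivity comes from residuation: meeting with a fixed element has a right adjoint, so it
  -- preserves joins.
  isBoundedDistributiveLattice : IsBoundedDistributiveLattice _≈_ _≤_ _∨_ _∧_ ⊤ ⊥
  isBoundedDistributiveLattice = record
    { isDistributiveLattice = isDistributiveLattice
    ; maximum               = maximum
    ; minimum               = minimum
    }

  module _ {n : Op₁ Carrier} {k : Carrier} (n-def : ∀ x → n x ≈ x ⇨ k) where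

    n-intro : ∀ {w x} → w ∧ x ≤ k → w ≤ n x
    n-intro w∧x≤k = trans (transpose-⇨ w∧x≤k) (reflexive (Eq.sym (n-def _)))

    n-apply : ∀ {w x} → w ≤ x → w ∧ n x ≤ k
    n-apply w≤x = trans (∧-monotonic refl (reflexive (n-def _))) (⇨-applyʳ w≤x)

    -- Modus ponens for `n`. Together with `n-intro` it reduces a claim `w ≤ n x` to bounding
    -- `w ∧ x` by some `z` and by `n z`.
    n-eliminate : ∀ {w x} → w ≤ x → w ≤ n x → w ≤ k
    n-eliminate w≤x w≤nx = trans (∧-greatest refl w≤nx) (n-apply w≤x)

    ⇨k-isMinimalNegation : IsMinimalNegation _≈_ _≤_ _∨_ _∧_ ⊤ ⊥ n
    ⇨k-isMinimalNegation = record
      { isPreminimalNegation = record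
        -- The element `n y ∧ x` lies below both `y` and `n y`.
        { antitone = λ x≤y →
            n-intro (n-eliminate (trans (x∧y≤y _ _) x≤y) (x∧y≤x _ _))
        ; n-∨      = λ x y → trans
            (∧-monotonic (reflexive (n-def x)) (reflexive (n-def y)))
            (trans (⇨-distribˡ-∨-∧-≥ x y k) (reflexive (Eq.sym (n-def _))))
        ; n-⊥      = antisym (maximum _) (n-intro (trans (x∧y≤y _ _) (minimum _)))
        }
      -- The same inequality `x ∧ n x ≤ k` is residuated with `n x` as the second factor.
      ; x≤nnx          = λ x → n-intro (n-apply refl)
      -- The element `(x ∧ n z) ∧ y` lies below `x ∧ y`, hence below `z`, and also below `n z`.
      ; contraposition = λ x∧y≤z → n-intro (n-eliminate
          (trans (∧-monotonic (x∧y≤x _ _) refl) x∧y≤z)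
          (trans (x∧y≤x _ _) (x∧y≤y _ _)))
      }

  ⇨⊥-isIntuitionisticNegation : {n : Op₁ Carrier} → (∀ x → n x ≈ x ⇨ ⊥) →
    IsIntuitionisticNegation _≈_ _≤_ _∨_ _∧_ ⊤ ⊥ n
  ⇨⊥-isIntuitionisticNegation n-def = record
    { isMinimalNegation = ⇨k-isMinimalNegation n-def
    -- Here `k` is `⊥`, so the bound `x ∧ n x ≤ k` continues to any `y`.
    ; explosion         = λ x y → trans (n-apply n-def refl) (minimum y)
    }

proposition6p7 : {c ℓ₁ ℓ₂ : Level} (A : CcpBa c ℓ₁ ℓ₂) →
    let open CcpBa A in
    IsKimAlgebra _≈_ _≤_ _∨_ _∧_ ¬_ ∼_ ⊤ ⊥
proposition6p7 A = record
  { isBoundedDistributiveLattice = isBoundedDistributiveLattice H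
  ; ¬-isIntuitionisticNegation   = ⇨⊥-isIntuitionisticNegation H ¬-def
  -- The law for `∼` is self-referential, but `k = ¬ ¬ ∼ ⊤` is one fixed element, independent of the
  -- argument.
  ; ∼-isMinimalNegation          = ⇨k-isMinimalNegation H ∼-def
  ; ¬¬∼⊤≈∼⊤                      = Eq.sym (Eq.trans (∼-def ⊤) (⇨-identityˡ H _))
  }
  where
  open CcpBa A
  H : HeytingAlgebra _ _ _
  H = record { isHeytingAlgebra = isHeytingAlgebra }
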